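{- Let $f\in 2^{[m]*}$ be nice and such that $K_f=\mathrm{supp}(f)$ is an abstract simplicial complex on vertex set $[m]$. Then there exists some $a\in\mathrm{supp}(f)$ such that $$|\mathrm{supp}(\mathcal{M}(f))|\geq 2^{m-|a|}.$$
   Context: Let $m$ be a positive integer, $[m]=\{1,\dots,m\}$, and $2^{[m]}$ the power set of $[m]$. $2^{[m]*}$ is the set of all functions $f:2^{[m]}\to\mathbb{Z}/2\mathbb{Z}=\{0,1\}$. The support is $\mathrm{supp}(f)=f^{ -1}(1)\subseteq 2^{[m]}$. An abstract simplicial complex is a collection of subsets closed under taking subsets (including the empty set); it is on vertex set $[m]$ if the union of its members is $[m]$. $f$ is nice if $\mathrm{supp}(f)$ is an abstract simplicial complex. The $\mathbb{Z}/2\mathbb{Z}$-valued Möbius transform $\mathcal{M}:2^{[m]*}\to 2^{[m]*}$ is $\mathcal{M}(f)(a)=\sum_{b\subseteq a}f(b)$. -}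

module Defs where

open import Data.Fin.Base using (Fin)
open import Data.Fin.Subset using (Subset; inside; outside; _∈_; _⊆_; ⊥)
open import Data.Fin.Subset.Properties using (_⊆?_)
open import Data.List.Base using (List; []; _∷_; _++_; map; filter; foldr; length)
open import Data.Nat.Base using (ℕ; zero; suc)
open import Data.Parity.Base using (Parity; 0ℙ; 1ℙ; _+_)
open import Data.Parity.Properties using (_≟_)
open import Data.Product.Base using (_×_; ∃-syntax)
import Data.Vec.Base as Vec
open import Level using (0ℓ)
open import Relation.Binary.PropositionalEquality.Core using (_≡_)
open import Relation.Unary using (Pred; Decidable)

-- Each of the 2 ^ m subsets of Fin m occurs exactly once.
allSubsets : ∀ m → List (Subset m)
allSubsets zero    = Vec.[] ∷ []
allSubsets (suc m) = map (outside Vec.∷_) (allSubsets m)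
                  ++ map (inside  Vec.∷_) (allSubsets m)

record IsSimplicialComplex {m : ℕ} (K : Pred (Subset m) 0ℓ) : Set where
  field
    ⊥∈K         : K ⊥
    down-closed : ∀ {a b} → b ⊆ a → K a → K b

-- The union of the members of K is all of Fin m.
record IsSimplicialComplexOnVertices {m : ℕ} (K : Pred (Subset m) 0ℓ) : Set where
  field
    isSimplicialComplex : IsSimplicialComplex K
    covers              : ∀ (i : Fin m) → ∃[ a ] (K a × i ∈ a)

-- Parity, with its addition, plays the role of ℤ/2ℤ.
BoolFun : ℕ → Set
BoolFun m = Subset m → Parity

supp : ∀ {m} → BoolFun m → Pred (Subset m) 0ℓ
supp f a = f a ≡ 1ℙ

supp? : ∀ {m} (f : BoolFun m) → Decidable (supp f)
supp? f a = f a ≟ 1ℙ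

∣supp_∣ : ∀ {m} → BoolFun m → ℕ
∣supp_∣ {m} f = length (filter (supp? f) (allSubsets m))

Nice : ∀ {m} → BoolFun m → Set
Nice f = IsSimplicialComplex (supp f)

möbius : ∀ {m} → BoolFun m → BoolFun m
möbius {m} f a = foldr _+_ 0ℙ (map f (filter (_⊆? a) (allSubsets m)))

{-# OPTIONS --safe #-}

-- Over 𝔽₂ the transform of f lists the values of the multilinear polynomial
-- Σ_b f(b) x^b, and the bound is the minimum distance of Reed–Muller codes.
-- Let f₀ and f₁ be the restrictions of f to the sets avoiding and containing the
-- first vertex. Then 𝓜 f is the (u | u + v) word with u = 𝓜 f₀ and v = 𝓜 f₁.
-- If f₁ ≠ 0, its weight is at least that of v, while both m and |a| drop by one;
-- if f₁ = 0, it is twice the weight of u.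
module Submission where

open import Defs
open import Data.Bool.Base using (true; false)
open import Data.Fin.Subset using (∣_∣; Subset; inside; outside)
open import Data.Fin.Subset.Properties
  using (_⊆?_; anySubset?; out⊆; in⊆in; drop-∷-⊆; ∣p∣≤n)
open import Data.List.Base using (List; []; _∷_; _++_; map; filter; foldr; length)
open import Data.List.Properties
  using (filter-≐; filter-++; filter-none; length-map; length-++; map-++; map-∘)
open import Data.List.Relation.Unary.All using (universal)
open import Data.Nat.Base as ℕ
  using (ℕ; zero; suc; NonZero; _∸_; _^_; _≤_; _≥_; s≤s)
import Data.Nat.Properties as ℕ
open import Data.Parity.Base using (Parity; 0ℙ; 1ℙ; _+_)
open import Data.Parity.Properties using (_≟_; +-assoc; +-identityʳ)
open import Data.Product.Base using (_×_; ∃-syntax; _,_)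
open import Data.Vec.Base using ([]; _∷_; here)
open import Function.Base using (_∘_)
open import Level using (Level)
open import Relation.Binary.PropositionalEquality
  using (_≡_; _≗_; refl; sym; trans; cong; cong₂; module ≡-Reasoning)
open import Relation.Nullary using (¬_; yes; no; does; contradiction)
open import Relation.Unary using (Pred; Decidable)

private variable
  a b p : Level
  A : Set a
  B : Set b
  m : ℕ

filter-map : {P : Pred B p} (P? : Decidable P) (g : A → B) (xs : List A) →
  filter P? (map g xs) ≡ map g (filter (P? ∘ g) xs)
filter-map P? g []       = refl
filter-map P? g (x ∷ xs) with ih ← filter-map P? g xs | does (P? (g x))
... | false = ih
... | true  = cong (g x ∷_) ih

sum : List Parity → Parity
sum = foldr _+_ 0ℙ

sum-++ : ∀ xs ys → sum (xs ++ ys) ≡ sum xs + sum ys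
sum-++ []       ys = refl
sum-++ (x ∷ xs) ys = trans (cong (x +_) (sum-++ xs ys)) (sym (+-assoc x (sum xs) (sum ys)))

sum-zero : {f : A → Parity} → (∀ x → f x ≡ 0ℙ) → ∀ xs → sum (map f xs) ≡ 0ℙ
sum-zero f≡0 []       = refl
sum-zero f≡0 (x ∷ xs) = cong₂ _+_ (f≡0 x) (sum-zero f≡0 xs)

-- Hamming weight along an arbitrary list, which permits induction on the list; `∣supp f ∣` unfolds
-- to `weight f (allSubsets m)`.
weight : (A → Parity) → List A → ℕ
weight f xs = length (filter (λ x → f x ≟ 1ℙ) xs)

weight-cong : {f g : A → Parity} → f ≗ g → weight f ≗ weight g
weight-cong f≗g xs = cong length (filter-≐ _ _
  ((λ {x} → trans (sym (f≗g x))) , (λ {x} → trans (f≗g x))) xs)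

-- In characteristic two `v` is the sum of `u` and `u + v`, so wherever `v` is 1 exactly one of
-- these two is 1. Slack arises only where `u` is 1 and `v` is 0: there both terms on the right
-- count and the left does not.
weight-subadditive : (u v : A → Parity) (xs : List A) →
  weight v xs ≤ weight u xs ℕ.+ weight (λ x → u x + v x) xs
weight-subadditive u v []       = ℕ.≤-refl
weight-subadditive u v (x ∷ xs) with ih ← weight-subadditive u v xs | u x | v x
... | 0ℙ | 0ℙ = ih
... | 0ℙ | 1ℙ = ℕ.≤-trans (s≤s ih) (ℕ.≤-reflexive (sym (ℕ.+-suc _ _)))
... | 1ℙ | 0ℙ = ℕ.≤-trans ih (ℕ.≤-trans (ℕ.+-monoʳ-≤ (weight u xs) (ℕ.n≤1+n _)) (ℕ.n≤1+n _))
... | 1ℙ | 1ℙ = s≤s ih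

∣supp∣-split : (g : BoolFun (suc m)) →
  ∣supp g ∣ ≡ ∣supp (g ∘ (outside ∷_)) ∣ ℕ.+ ∣supp (g ∘ (inside ∷_)) ∣
∣supp∣-split {m} g = begin
  length (filter (supp? g) (map (outside ∷_) S ++ map (inside ∷_) S))
    ≡⟨ cong length (filter-++ (supp? g) (map (outside ∷_) S) _) ⟩
  length (filter (supp? g) (map (outside ∷_) S) ++ filter (supp? g) (map (inside ∷_) S))
    ≡⟨ length-++ (filter (supp? g) (map (outside ∷_) S)) ⟩
  length (filter (supp? g) (map (outside ∷_) S)) ℕ.+ length (filter (supp? g) (map (inside ∷_) S))
    ≡⟨ cong₂ ℕ._+_ (half outside) (half inside) ⟩
  ∣supp (g ∘ (outside ∷_)) ∣ ℕ.+ ∣supp (g ∘ (inside ∷_)) ∣ ∎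
  where
  open ≡-Reasoning
  S = allSubsets m
  half : ∀ s → length (filter (supp? g) (map (s ∷_) S)) ≡ ∣supp (g ∘ (s ∷_)) ∣
  half s = trans (cong length (filter-map (supp? g) (s ∷_) S))
                 (length-map (s ∷_) (filter (supp? (g ∘ (s ∷_))) S))

module _ (f : BoolFun (suc m)) (c : Subset m) where

  private
    S = allSubsets m

    -- The share of `möbius f (t ∷ c)` contributed by the sets `s ∷ b`. Inclusion is tested on the
    -- full vectors; depending on `s` and `t`, the test amounts to `b ⊆ c` or always fails.
    sumOver : ∀ s t → Parity
    sumOver s t = sum (map (f ∘ (s ∷_)) (filter (λ b → (s ∷ b) ⊆? (t ∷ c)) S))

    möbius-split : ∀ t → möbius f (t ∷ c) ≡ sumOver outside t + sumOver inside t
    möbius-split t = begin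
      sum (map f (filter P? (map (outside ∷_) S ++ map (inside ∷_) S)))
        ≡⟨ cong (sum ∘ map f) (filter-++ P? (map (outside ∷_) S) _) ⟩
      sum (map f (filter P? (map (outside ∷_) S) ++ filter P? (map (inside ∷_) S)))
        ≡⟨ cong sum (map-++ f (filter P? (map (outside ∷_) S)) _) ⟩
      sum (map f (filter P? (map (outside ∷_) S)) ++ map f (filter P? (map (inside ∷_) S)))
        ≡⟨ sum-++ (map f (filter P? (map (outside ∷_) S))) _ ⟩
      sum (map f (filter P? (map (outside ∷_) S))) + sum (map f (filter P? (map (inside ∷_) S)))
        ≡⟨ cong₂ _+_ (half outside) (half inside) ⟩
      sumOver outside t + sumOver inside t ∎
      where
      open ≡-Reasoning
      P? = _⊆? (t ∷ c)
      half : ∀ s → sum (map f (filter P? (map (s ∷_) S))) ≡ sumOver s t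
      half s = cong sum (trans (cong (map f) (filter-map P? (s ∷_) S)) (sym (map-∘ _)))

    sumOver-outside : ∀ t → sumOver outside t ≡ möbius (f ∘ (outside ∷_)) c
    sumOver-outside t = cong (sum ∘ map _) (filter-≐ _ (_⊆? c) (drop-∷-⊆ , out⊆) S)

  möbius-outside : möbius f (outside ∷ c) ≡ möbius (f ∘ (outside ∷_)) c
  möbius-outside = begin
    möbius f (outside ∷ c)
      ≡⟨ möbius-split outside ⟩
    sumOver outside outside + sumOver inside outside
      ≡⟨ cong₂ _+_ (sumOver-outside outside) (cong (sum ∘ map _)
           -- A set containing the first vertex is never included in one that avoids it, so this
           -- share is an empty sum.
           (filter-none _ (universal (λ b b⊆c → contradiction (b⊆c here) λ ()) S))) ⟩
    möbius (f ∘ (outside ∷_)) c + 0ℙ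
      ≡⟨ +-identityʳ _ ⟩
    möbius (f ∘ (outside ∷_)) c ∎
    where open ≡-Reasoning

  möbius-inside : möbius f (inside ∷ c) ≡ möbius (f ∘ (outside ∷_)) c + möbius (f ∘ (inside ∷_)) c
  möbius-inside = trans (möbius-split inside)
    (cong₂ _+_ (sumOver-outside inside)
      (cong (sum ∘ map _) (filter-≐ _ (_⊆? c) (drop-∷-⊆ , in⊆in) S)))

∣supp-möbius∣-split : (f : BoolFun (suc m)) →
  let u = möbius (f ∘ (outside ∷_)); v = möbius (f ∘ (inside ∷_)) in
  ∣supp möbius f ∣ ≡ ∣supp u ∣ ℕ.+ ∣supp (λ c → u c + v c) ∣
∣supp-möbius∣-split {m} f = trans (∣supp∣-split (möbius f))
  (cong₂ ℕ._+_ (weight-cong (möbius-outside f) (allSubsets m))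
               (weight-cong (möbius-inside f) (allSubsets m)))

∉supp⇒≡0ℙ : (f : BoolFun m) → ∀ {a} → ¬ supp f a → f a ≡ 0ℙ
∉supp⇒≡0ℙ f {a} a∉supp with f a
... | 0ℙ = refl
... | 1ℙ = contradiction refl a∉supp

-- Induction on `m`, with `b` certifying that `f` is nonzero. The set `a` is built greedily, taking
-- a vertex whenever some set of the current support contains it; it is thus the lexicographically
-- leading monomial of the polynomial.
∣supp-möbius∣≥2^ : ∀ m (f : BoolFun m) {b} → supp f b →
  ∃[ a ] (supp f a × ∣supp möbius f ∣ ≥ 2 ^ (m ∸ ∣ a ∣))
∣supp-möbius∣≥2^ zero f {[]} fb≡1 =
  -- The bound `2 ^ 0` is read as the weight of the constant 1 on the single subset of the empty
  -- vertex set.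
  [] , fb≡1 , ℕ.≤-reflexive (weight-cong {f = λ _ → 1ℙ} 1≡möbius (allSubsets 0))
  where
  1≡möbius : ∀ c → 1ℙ ≡ möbius f c
  1≡möbius [] = sym (trans (+-identityʳ _) fb≡1)
∣supp-möbius∣≥2^ (suc m) f {b} fb≡1 with anySubset? (supp? (f ∘ (inside ∷_)))
... | yes (b′ , fb′≡1) with ∣supp-möbius∣≥2^ m (f ∘ (inside ∷_)) fb′≡1
...   | a , fa≡1 , bound = inside ∷ a , fa≡1 , (begin
  -- The exponent `suc m ∸ ∣ inside ∷ a ∣` reduces to this one, since both terms grow by one.
  2 ^ (m ∸ ∣ a ∣)                                  ≤⟨ bound ⟩
  ∣supp v ∣                                        ≤⟨ weight-subadditive u v (allSubsets m) ⟩
  ∣supp u ∣ ℕ.+ ∣supp (λ c → u c + v c) ∣          ≡⟨ ∣supp-möbius∣-split f ⟨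
  ∣supp möbius f ∣                                 ∎)
  where
  open ℕ.≤-Reasoning
  u = möbius (f ∘ (outside ∷_))
  v = möbius (f ∘ (inside ∷_))
∣supp-möbius∣≥2^ (suc m) f {inside  ∷ b} fb≡1 | no f₁≡0 = contradiction (b , fb≡1) f₁≡0
∣supp-möbius∣≥2^ (suc m) f {outside ∷ b} fb≡1 | no f₁≡0
  with ∣supp-möbius∣≥2^ m (f ∘ (outside ∷_)) fb≡1
... | a , fa≡1 , bound = outside ∷ a , fa≡1 , (begin
  -- Subtraction is truncated, so `∣ a ∣ ≤ m` is what lets the exponent grow by one and the bound
  -- double.
  2 ^ (suc m ∸ ∣ a ∣)                              ≡⟨ cong (2 ^_) (ℕ.+-∸-assoc 1 (∣p∣≤n a)) ⟩
  2 ^ (m ∸ ∣ a ∣) ℕ.+ (2 ^ (m ∸ ∣ a ∣) ℕ.+ 0)      ≡⟨ cong (2 ^ (m ∸ ∣ a ∣) ℕ.+_) (ℕ.+-identityʳ _) ⟩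
  2 ^ (m ∸ ∣ a ∣) ℕ.+ 2 ^ (m ∸ ∣ a ∣)              ≤⟨ ℕ.+-mono-≤ bound bound ⟩
  ∣supp u ∣ ℕ.+ ∣supp u ∣                          ≡⟨ cong (∣supp u ∣ ℕ.+_) (weight-cong u≗u+v (allSubsets m)) ⟩
  ∣supp u ∣ ℕ.+ ∣supp (λ c → u c + v c) ∣          ≡⟨ ∣supp-möbius∣-split f ⟨
  ∣supp möbius f ∣                                 ∎)
  where
  open ℕ.≤-Reasoning
  u = möbius (f ∘ (outside ∷_))
  v = möbius (f ∘ (inside ∷_))
  v≡0 : ∀ c → v c ≡ 0ℙ
  v≡0 c = sum-zero (λ a → ∉supp⇒≡0ℙ (f ∘ (inside ∷_)) (λ fa≡1 → f₁≡0 (a , fa≡1)))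
    (filter (_⊆? c) (allSubsets m))
  u≗u+v : ∀ c → u c ≡ u c + v c
  u≗u+v c = sym (trans (cong (u c +_) (v≡0 c)) (+-identityʳ (u c)))

theorem1p2 : ∀ (m : ℕ) .{{_ : NonZero m}} (f : BoolFun m) →
    Nice f → IsSimplicialComplexOnVertices (supp f) →
    ∃[ a ] (supp f a × ∣supp möbius f ∣ ≥ 2 ^ (m ∸ ∣ a ∣))
-- A simplicial complex contains the empty set, which gives the point of the support that starts the
-- induction.
theorem1p2 m f nice _ = ∣supp-möbius∣≥2^ m f (IsSimplicialComplex.⊥∈K nice)
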